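{- Let $\Sigma$ be a many-sorted signature and $S\subseteq\mathcal{S}_\Sigma$ with $|S|=1$. If a $\Sigma$-theory $\mathcal{T}$ has the finite model property with respect to $S$, then $\mathcal{T}$ is stably finite with respect to $S$.
   Context: A many-sorted signature $\Sigma$ has a countable set of sorts $\mathcal{S}_{\Sigma}$, countably many function and predicate symbols with arities over these sorts, and an equality symbol for each sort (interpreted as identity). A $\Sigma$-interpretation $\mathcal{A}$ is a $\Sigma$-structure (domain $\sigma^{\mathcal{A}}$ for each sort $\sigma$) together with values for all variables. A $\Sigma$-theory $\mathcal{T}$ is the class of all $\Sigma$-interpretations (the $\mathcal{T}$-interpretations) satisfying a given set of closed formulas; a formula is $\mathcal{T}$-satisfiable if some $\mathcal{T}$-interpretation satisfies it. $\mathcal{T}$ has the finite model property w.r.t. $S$ if every $\mathcal{T}$-satisfiable quantifier-free $\Sigma$-formula is satisfied by some $\mathcal{T}$-interpretation $\mathcal{A}$ with $\sigma^{\mathcal{A}}$ finite for each $\sigma\in S$. $\mathcal{T}$ is stably finite w.r.t. $S$ if for every quantifier-free $\Sigma$-formula $\phi$ and every $\mathcal{T}$-interpretation $\mathcal{A}$ satisfying $\phi$ there is a $\mathcal{T}$-interpretation $\mathcal{B}$ satisfying $\phi$ with $|\sigma^{\mathcal{B}}|$ finite and $|\sigma^{\mathcal{B}}|\le|\sigma^{\mathcal{A}}|$ for each $\sigma\in S$. -}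

module Defs where

open import Data.Fin.Base using (Fin)
open import Data.List.Base using (List)
open import Data.List.Relation.Unary.All using (All; []; _∷_)
open import Data.Nat.Base using (ℕ)
open import Data.Nat.Properties using () renaming (_≟_ to _≟ℕ_)
open import Data.Product.Base using (∃; _×_; _,_; proj₁)
open import Data.Product.Properties using (≡-dec)
open import Data.Sum.Base using (_⊎_)
open import Function.Bundles using (_↣_; _↔_; _⇔_)
open import Level using (Level; suc; _⊔_; 0ℓ)
open import Relation.Binary.Definitions using (DecidableEquality)
open import Relation.Binary.PropositionalEquality.Core using (_≡_; refl)
open import Relation.Nullary.Decidable.Core using (yes; no)
open import Relation.Nullary.Decidable using (via-injection)
open import Relation.Nullary.Negation.Core using (¬_)
open import Relation.Unary using (Pred; _∈_; ∅; _∪_; _∖_; ｛_｝; Empty; _⊆_)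

-- "Countable" includes "finite": it means injecting into ℕ.
-- Constants and propositional letters are the symbols with domain [].
record Signature : Set₁ where
  field
    Sort : Set
    Fun  : Set
    Rel  : Set
    sort-countable : Sort ↣ ℕ
    fun-countable  : Fun ↣ ℕ
    rel-countable  : Rel ↣ ℕ
    dom   : Fun → List Sort
    cod   : Fun → Sort
    arity : Rel → List Sort

module _ (Σ : Signature) where
  open Signature Σ

  -- The variables of a sort σ are the pairs (σ , n) with n : ℕ.
  Var : Set
  Var = Sort × ℕ

  _≟Var_ : DecidableEquality Var
  _≟Var_ = ≡-dec (via-injection sort-countable _≟ℕ_) _≟ℕ_

  data Term : Sort → Set where
    var : ∀ {σ} → ℕ → Term σ
    fun : (f : Fun) → All Term (dom f) → Term (cod f)

  infix  8 _≈_
  infix  7 ∼_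
  infixr 6 _∧_
  infixr 5 _∨_
  infixr 4 _⟹_
  infix  3 _⟺_

  data Formula : Set where
    _≈_  : ∀ {σ} → Term σ → Term σ → Formula
    rel  : (R : Rel) → All Term (arity R) → Formula
    ∼_   : Formula → Formula
    _∧_ _∨_ _⟹_ _⟺_ : Formula → Formula → Formula
    all ex : Var → Formula → Formula

  data QuantifierFree : Pred Formula 0ℓ where
    _≈_  : ∀ {σ} (s t : Term σ) → QuantifierFree (s ≈ t)
    rel  : ∀ R ts → QuantifierFree (rel R ts)
    ∼_   : ∀ {φ} → QuantifierFree φ → QuantifierFree (∼ φ)
    _∧_  : ∀ {φ ψ} → QuantifierFree φ → QuantifierFree ψ → QuantifierFree (φ ∧ ψ)
    _∨_  : ∀ {φ ψ} → QuantifierFree φ → QuantifierFree ψ → QuantifierFree (φ ∨ ψ)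
    _⟹_ : ∀ {φ ψ} → QuantifierFree φ → QuantifierFree ψ → QuantifierFree (φ ⟹ ψ)
    _⟺_ : ∀ {φ ψ} → QuantifierFree φ → QuantifierFree ψ → QuantifierFree (φ ⟺ ψ)

  mutual
    FVᵗ : ∀ {σ} → Term σ → Pred Var 0ℓ
    FVᵗ (var {σ} n) = ｛ σ , n ｝
    FVᵗ (fun f ts)  = FVᵗˢ ts

    FVᵗˢ : ∀ {σs} → All Term σs → Pred Var 0ℓ
    FVᵗˢ []       = ∅
    FVᵗˢ (t ∷ ts) = FVᵗ t ∪ FVᵗˢ ts

  FV : Formula → Pred Var 0ℓ
  FV (s ≈ t)    = FVᵗ s ∪ FVᵗ t
  FV (rel R ts) = FVᵗˢ ts
  FV (∼ φ)      = FV φ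
  FV (φ ∧ ψ)    = FV φ ∪ FV ψ
  FV (φ ∨ ψ)    = FV φ ∪ FV ψ
  FV (φ ⟹ ψ)   = FV φ ∪ FV ψ
  FV (φ ⟺ ψ)   = FV φ ∪ FV ψ
  FV (all x φ)  = FV φ ∖ ｛ x ｝
  FV (ex x φ)   = FV φ ∖ ｛ x ｝

  Closed : Pred Formula 0ℓ
  Closed φ = Empty (FV φ)

  record Structure ℓ : Set (suc ℓ) where
    field
      ⟦_⟧  : Sort → Set ℓ
      ⟦fun⟧ : (f : Fun) → All ⟦_⟧ (dom f) → ⟦ cod f ⟧
      ⟦rel⟧ : (R : Rel) → All ⟦_⟧ (arity R) → Set ℓ

  module _ {ℓ} (M : Structure ℓ) where
    open Structure M

    Valuation : Set ℓ
    Valuation = ((σ , n) : Var) → ⟦ σ ⟧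

    _[_↦_] : Valuation → (x : Var) → ⟦ proj₁ x ⟧ → Valuation
    (ν [ x ↦ a ]) y with x ≟Var y
    ... | yes refl = a
    ... | no  _    = ν y

    mutual
      eval : Valuation → ∀ {σ} → Term σ → ⟦ σ ⟧
      eval ν (var {σ} n) = ν (σ , n)
      eval ν (fun f ts)  = ⟦fun⟧ f (evals ν ts)

      evals : Valuation → ∀ {σs} → All Term σs → All ⟦_⟧ σs
      evals ν []       = []
      evals ν (t ∷ ts) = eval ν t ∷ evals ν ts

    Holds : Valuation → Formula → Set ℓ
    Holds ν (s ≈ t)    = eval ν s ≡ eval ν t
    Holds ν (rel R ts) = ⟦rel⟧ R (evals ν ts)
    Holds ν (∼ φ)      = ¬ Holds ν φ
    Holds ν (φ ∧ ψ)    = Holds ν φ × Holds ν ψ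
    Holds ν (φ ∨ ψ)    = Holds ν φ ⊎ Holds ν ψ
    Holds ν (φ ⟹ ψ)   = Holds ν φ → Holds ν ψ
    Holds ν (φ ⟺ ψ)   = Holds ν φ ⇔ Holds ν ψ
    Holds ν (all x φ)  = ∀ a → Holds (ν [ x ↦ a ]) φ
    Holds ν (ex x φ)   = ∃ λ a → Holds (ν [ x ↦ a ]) φ

  -- The valuation is total, so every domain of an interpretation is inhabited.
  record Interpretation ℓ : Set (suc ℓ) where
    field
      structure : Structure ℓ
      valuation : Valuation structure
    open Structure structure public

  _⊨_ : ∀ {ℓ} → Interpretation ℓ → Formula → Set ℓ
  𝒜 ⊨ φ = Holds structure valuation φ
    where open Interpretation 𝒜

  record Theory a : Set (suc a) where
    field
      Axiom  : Pred Formula a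
      closed : Axiom ⊆ Closed

Finite : ∀ {ℓ} → Set ℓ → Set ℓ
Finite A = ∃ λ n → A ↔ Fin n

module _ {Σ : Signature} {a} (T : Theory Σ a) where
  open Signature Σ
  open Theory T
  open Interpretation using (⟦_⟧)

  Models : ∀ {ℓ} → Pred (Interpretation Σ ℓ) (a ⊔ ℓ)
  Models 𝒜 = ∀ φ → φ ∈ Axiom → _⊨_ Σ 𝒜 φ

  -- ℓ is the universe in which the domains of interpretations live.
  module _ (ℓ : Level) where

    Satisfiable : Pred (Formula Σ) (a ⊔ suc ℓ)
    Satisfiable φ = ∃ λ (𝒜 : Interpretation Σ ℓ) → 𝒜 ∈ Models × _⊨_ Σ 𝒜 φ

    FiniteModelProperty : ∀ {s} → Pred Sort s → Set (a ⊔ s ⊔ suc ℓ)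
    FiniteModelProperty S =
      ∀ φ → QuantifierFree Σ φ → Satisfiable φ →
      ∃ λ (𝒜 : Interpretation Σ ℓ) → 𝒜 ∈ Models × _⊨_ Σ 𝒜 φ ×
        (∀ σ → σ ∈ S → Finite (⟦ 𝒜 ⟧ σ))

    StablyFinite : ∀ {s} → Pred Sort s → Set (a ⊔ s ⊔ suc ℓ)
    StablyFinite S =
      ∀ φ → QuantifierFree Σ φ →
      (𝒜 : Interpretation Σ ℓ) → 𝒜 ∈ Models → _⊨_ Σ 𝒜 φ →
      ∃ λ (ℬ : Interpretation Σ ℓ) → ℬ ∈ Models × _⊨_ Σ ℬ φ ×
        (∀ σ → σ ∈ S → Finite (⟦ ℬ ⟧ σ) × (⟦ ℬ ⟧ σ ↣ ⟦ 𝒜 ⟧ σ))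

{-# OPTIONS --safe #-}
module Submission where

open import Defs
open import Axiom.ExcludedMiddle using (ExcludedMiddle)
open import Axiom.DoubleNegationElimination using (em⇒dne)
open import Data.Fin.Base using (Fin; zero; suc)
open import Data.Nat.Base using (zero; suc)
open import Data.Product using (∃!; ∃; _×_; _,_)
open import Data.Vec.Functional using (_∷_)
open import Function.Bundles using (_↣_; mk↣; mk⤖; module Injection)
open import Function.Consequences.Propositional using (strictlySurjective⇒surjective)
open import Function.Construct.Composition using (_↣-∘_)
open import Function.Construct.Identity using (↣-id)
open import Function.Definitions using (Injective)
open import Function.Properties.Bijection using (⤖⇒↔)
open import Function.Properties.Inverse using (↔-sym; ↔⇒↣)
open import Relation.Binary.PropositionalEquality using (_≡_; _≢_; refl; sym; cong)
open import Relation.Nullary.Decidable.Core using (yes; no)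
open import Relation.Nullary.Negation.Core using (¬_; contradiction)
open import Relation.Unary using (Pred)

-- A model whose S-domain is finite is its own witness. Otherwise that domain is
-- infinite, so every finite set injects into it, in particular the domain of the
-- model that the finite model property provides.

∷-injective : ∀ {ℓ} {A : Set ℓ} {n a} {f : Fin n → A} →
  Injective _≡_ _≡_ f → (∀ i → f i ≢ a) → Injective _≡_ _≡_ (a ∷ f)
∷-injective inj a∉f {zero}  {zero}  _  = refl
∷-injective inj a∉f {zero}  {suc j} eq = contradiction (sym eq) (a∉f j)
∷-injective inj a∉f {suc i} {zero}  eq = contradiction eq (a∉f i)
∷-injective inj a∉f {suc i} {suc j} eq = cong suc (inj eq)

module _ {ℓ} (em : ExcludedMiddle ℓ) {A : Set ℓ} where

  -- An injection from `Fin n` that missed no element would be a bijection, and its inverse would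
  -- witness that `A` is finite.
  infinite⇒∃∉image : ¬ Finite A → ∀ {n} (f : Fin n ↣ A) →
    ∃ λ a → ∀ i → Injection.to f i ≢ a
  infinite⇒∃∉image ¬fin {n} f = em⇒dne em λ ¬∃ →
    -- `¬∃` only refutes that `a` is missed; a second, pointwise double negation elimination turns
    -- this into an actual preimage.
    let surj = λ a → em⇒dne em λ a∉f → ¬∃ (a , λ i eq → a∉f (i , eq))
    in ¬fin (n , ↔-sym (⤖⇒↔ (mk⤖ (injective , strictlySurjective⇒surjective surj))))
    where open Injection f

  -- Induction on `n`: the injection built so far misses some element, which becomes the value at
  -- the new index `zero`.
  infinite⇒Fin↣ : ¬ Finite A → ∀ n → Fin n ↣ A
  infinite⇒Fin↣ ¬fin zero    = mk↣ {to = λ ()} λ { {()} }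
  infinite⇒Fin↣ ¬fin (suc n) =
    let f       = infinite⇒Fin↣ ¬fin n
        a , a∉f = infinite⇒∃∉image ¬fin f
    in mk↣ (∷-injective (Injection.injective f) a∉f)

theorem4 : ∀ {ℓ a s} → ExcludedMiddle ℓ →
    (Σ : Signature) (S : Pred (Signature.Sort Σ) s) → ∃! _≡_ S →
    (T : Theory Σ a) → FiniteModelProperty T ℓ S → StablyFinite T ℓ S
theorem4 em Σ S (σ , _ , unique) T fmp φ qf 𝒜 𝒜⊨T 𝒜⊨φ
  with em {Finite (Interpretation.⟦_⟧ 𝒜 σ)}
... | yes fin = 𝒜 , 𝒜⊨T , 𝒜⊨φ , λ τ τ∈S → bound τ (unique τ∈S)
  where
  -- Any sort in `S` equals `σ` by `unique`; with `τ` general, matching on `refl` transports the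
  -- finiteness of the `σ`-domain to it.
  bound : ∀ τ → σ ≡ τ →
    Finite (Interpretation.⟦_⟧ 𝒜 τ) × (Interpretation.⟦_⟧ 𝒜 τ ↣ Interpretation.⟦_⟧ 𝒜 τ)
  bound _ refl = fin , ↣-id _
... | no ¬fin =
  -- `𝒜` itself shows that `φ` is satisfiable. The size of the resulting `ℬ` need not be known, as
  -- any finite size fits into the infinite domain of `𝒜`.
  let ℬ , ℬ⊨T , ℬ⊨φ , ℬ-finite = fmp φ qf (𝒜 , 𝒜⊨T , 𝒜⊨φ)
  in ℬ , ℬ⊨T , ℬ⊨φ , λ τ τ∈S → bound ℬ τ (unique τ∈S) (ℬ-finite τ τ∈S)
  where
  bound : ∀ ℬ τ → σ ≡ τ → Finite (Interpretation.⟦_⟧ ℬ τ) →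
    Finite (Interpretation.⟦_⟧ ℬ τ) × (Interpretation.⟦_⟧ ℬ τ ↣ Interpretation.⟦_⟧ 𝒜 τ)
  -- The injection factors through `Fin n`: first enumerate the domain of `ℬ`, then embed the
  -- indices.
  bound ℬ _ refl (n , ℬ↔n) = (n , ℬ↔n) , infinite⇒Fin↣ em ¬fin n ↣-∘ ↔⇒↣ ℬ↔n
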